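{- (1) Let $\mathbb{P}_\tau=(P_o,P_a,\vDash,\mathcal{F}_\tau)$ be an attribute continuous formal context. Then the set $\mathfrak{B}(P_a,\mathcal{F}_\tau)$ of its continuous formal concepts, ordered by set inclusion, is a continuous domain. (2) Conversely, for every continuous domain $(D,\leq)$ there exists an attribute continuous formal context $\mathbb{P}_\tau=(P_o,P_a,\vDash,\mathcal{F}_\tau)$ such that $(D,\leq)$ is order isomorphic to $(\mathfrak{B}(P_a,\mathcal{F}_\tau),\subseteq)$.
   Context: Domain theory. Posets are assumed nonempty. A dcpo is a poset in which every directed (nonempty, upward directed) subset has a least upper bound. In a dcpo $P$, $x\ll y$ means: for every directed $D\subseteq P$ with $y\leq\bigvee D$ there is $d\in D$ with $x\leq d$. A basis of $P$ is a subset $B\subseteq P$ such that for every $x\in P$ the set $\{b\in B: b\ll x\}$ is directed with least upper bound $x$. A continuous domain is a dcpo that has a basis. Notation: $M\sqsubseteq X$ means that $M$ is a finite subset of $X$ (possibly empty). A formal context is a triple $(P_o,P_a,\vDash)$ with sets $P_o$ (objects), $P_a$ (attributes) and a relation $\vDash\subseteq P_o\times P_a$. Define $\alpha:\mathcal{P}(P_o)\to\mathcal{P}(P_a)$, $\alpha(A)=\{n\in P_a:\forall m\in A,\ m\vDash n\}$ and $\omega:\mathcal{P}(P_a)\to\mathcal{P}(P_o)$, $\omega(B)=\{m\in P_o:\forall n\in B,\ m\vDash n\}$. A kernel attribute operator on $(P_o,P_a,\vDash)$ is a map $\tau:\mathcal{P}(P_a)\to\mathcal{P}(P_a)$ such that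 for all $B,B_1\subseteq P_a$: $\tau(\alpha(\omega(B)))\subseteq\alpha(\omega(B))$; $\tau(\tau(\alpha(\omega(B))))=\tau(\alpha(\omega(B)))$; and $\tau(\alpha(\omega(B)))\subseteq\tau(\alpha(\omega(B_1)))$ whenever $B\subseteq B_1$. Write $\lceil B\rceil=\tau(\alpha(\omega(B)))$. A $\tau$-consistent selection is a nonempty family $\mathcal{F}_\tau$ of nonempty finite subsets of $P_a$ such that for every $F\in\mathcal{F}_\tau$ and every $M\sqsubseteq\lceil F\rceil$ there is $G\in\mathcal{F}_\tau$ with $M\subseteq\lceil G\rceil$ and $G\subseteq\lceil F\rceil$. An attribute continuous formal context is a structure $\mathbb{P}_\tau=(P_o,P_a,\vDash,\mathcal{F}_\tau)$ where $(P_o,P_a,\vDash)$ is a formal context, $\tau$ is a kernel attribute operator on it and $\mathcal{F}_\tau$ is a $\tau$-consistent selection. A continuous formal concept of $\mathbb{P}_\tau$ is a subset $Q\subseteq P_a$ such that for every $M\sqsubseteq Q$ there is $F\in\mathcal{F}_\tau$ with $M\subseteq\lceil F\rceil\subseteq Q$. The set of all of them is $\mathfrak{B}(P_a,\mathcal{F}_\tau)$. -}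

module Defs where

open import Data.List.Base using (List; [])
open import Data.List.Membership.Propositional using () renaming (_∈_ to _∈ₗ_)
open import Data.List.Relation.Unary.All using (All)
open import Data.Product.Base using (∃; ∃-syntax; _×_; proj₁)
open import Level using (Level; Lift; _⊔_; suc)
open import Relation.Binary.Bundles using (Poset)
open import Relation.Binary.Core using (REL)
import Relation.Binary.Construct.On as On
open import Relation.Binary.Morphism.Structures using (IsOrderIsomorphism)
open import Relation.Binary.PropositionalEquality.Core using (_≢_)
open import Relation.Unary using (Pred; _∈_; _⊆_; _≐_; Satisfiable)
open import Relation.Unary.Relation.Binary.Subset using (⊆-poset)

private
  variable
    o a r c ℓ ℓ₁ ℓ₂ c′ ℓ₁′ ℓ₂′ : Level

-- Subsets of a poset need not respect _≈_: directedness, least upper bounds,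
-- way-below and bases do not change when a subset is closed under _≈_.
--
-- Subsets are taken at the fixed level c ⊔ ℓ₂; under excluded middle every
-- predicate is equivalent to one at this level, so nothing is lost.

module _ (P : Poset c ℓ₁ ℓ₂) where
  open Poset P

  IsDirected : Pred Carrier ℓ → Set (c ⊔ ℓ₂ ⊔ ℓ)
  IsDirected S =
    Satisfiable S ×
    (∀ {x y} → x ∈ S → y ∈ S → ∃[ z ] z ∈ S × x ≤ z × y ≤ z)

  IsLub : Pred Carrier ℓ → Carrier → Set (c ⊔ ℓ₂ ⊔ ℓ)
  IsLub S u =
    (∀ {x} → x ∈ S → x ≤ u) ×
    (∀ v → (∀ {x} → x ∈ S → x ≤ v) → u ≤ v)

  WayBelow : Carrier → Carrier → Set (suc (c ⊔ ℓ₂))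
  WayBelow x y =
    (S : Pred Carrier (c ⊔ ℓ₂)) → IsDirected S →
    ∀ u → IsLub S u → y ≤ u → ∃[ d ] d ∈ S × x ≤ d

  IsBasis : Pred Carrier (c ⊔ ℓ₂) → Set (suc (c ⊔ ℓ₂))
  IsBasis B = ∀ x → IsDirected (B-below x) × IsLub (B-below x) x
    where
    B-below : Carrier → Pred Carrier (suc (c ⊔ ℓ₂))
    B-below x b = b ∈ B × WayBelow b x

  record IsDCPO : Set (suc (c ⊔ ℓ₂)) where
    field
      nonempty         : Carrier
      directedComplete : (S : Pred Carrier (c ⊔ ℓ₂)) → IsDirected S →
                         ∃ (IsLub S)

  record IsContinuousDomain : Set (suc (c ⊔ ℓ₂)) where
    field
      isDCPO : IsDCPO
      basis  : ∃ IsBasis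

_≅_ : Poset c ℓ₁ ℓ₂ → Poset c′ ℓ₁′ ℓ₂′ → Set _
P ≅ Q = ∃ (IsOrderIsomorphism P._≈_ Q._≈_ P._≤_ Q._≤_)
  where
  module P = Poset P
  module Q = Poset Q

-- A list stands for the finite set of its entries.
infix 4 _⊑_

_⊑_ : {A : Set a} → List A → Pred A ℓ → Set (a ⊔ ℓ)
M ⊑ X = All (_∈ X) M

record FormalContext o a r : Set (suc (o ⊔ a ⊔ r)) where
  infix 4 _⊨_
  field
    Object    : Set o
    Attribute : Set a
    _⊨_       : REL Object Attribute r

  -- The least level at which α and ω are both maps between powersets.
  𝒫 : Set ℓ → Set (ℓ ⊔ suc (o ⊔ a ⊔ r))
  𝒫 X = Pred X (o ⊔ a ⊔ r)

  α : 𝒫 Object → 𝒫 Attribute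
  α A n = ∀ m → m ∈ A → m ⊨ n

  ω : 𝒫 Attribute → 𝒫 Object
  ω B m = ∀ n → n ∈ B → m ⊨ n

  elements : List Attribute → 𝒫 Attribute
  elements F n = Lift (o ⊔ r) (n ∈ₗ F)

record KernelAttributeOperator (K : FormalContext o a r)
       : Set (suc (o ⊔ a ⊔ r)) where
  open FormalContext K
  field
    τ : 𝒫 Attribute → 𝒫 Attribute
    -- Equality of subsets is _≐_, so being a map on the powerset includes:
    τ-cong       : ∀ {B B₁} → B ≐ B₁ → τ B ≐ τ B₁
    τ-deflating  : ∀ B → τ (α (ω B)) ⊆ α (ω B)
    τ-idempotent : ∀ B → τ (τ (α (ω B))) ≐ τ (α (ω B))
    τ-monotone   : ∀ {B B₁} → B ⊆ B₁ → τ (α (ω B)) ⊆ τ (α (ω B₁))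

  ⌈_⌉ : 𝒫 Attribute → 𝒫 Attribute
  ⌈ B ⌉ = τ (α (ω B))

record ConsistentSelection {K : FormalContext o a r}
       (T : KernelAttributeOperator K) : Set (suc (o ⊔ a ⊔ r)) where
  open FormalContext K
  open KernelAttributeOperator T
  field
    ℱ          : 𝒫 (List Attribute)
    ℱ-nonempty : Satisfiable ℱ
    ∈ℱ⇒≢[]     : ∀ {F} → F ∈ ℱ → F ≢ []
    consistent : ∀ {F} → F ∈ ℱ → ∀ M → M ⊑ ⌈ elements F ⌉ →
                 ∃[ G ] G ∈ ℱ × M ⊑ ⌈ elements G ⌉ × G ⊑ ⌈ elements F ⌉

record AttributeContinuousFormalContext o a r : Set (suc (o ⊔ a ⊔ r)) where
  field
    context   : FormalContext o a r
    operator  : KernelAttributeOperator context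
    selection : ConsistentSelection operator

  open FormalContext context public
  open KernelAttributeOperator operator public
  open ConsistentSelection selection public

  IsContinuousConcept : 𝒫 Attribute → Set (o ⊔ a ⊔ r)
  IsContinuousConcept Q =
    ∀ M → M ⊑ Q → ∃[ F ] F ∈ ℱ × M ⊑ ⌈ elements F ⌉ × ⌈ elements F ⌉ ⊆ Q

𝔅 : AttributeContinuousFormalContext o a r →
    Poset (suc (o ⊔ a ⊔ r)) (o ⊔ a ⊔ r) (o ⊔ a ⊔ r)
𝔅 {o} {a} {r} ℙ =
  On.poset {B = ∃ IsContinuousConcept} (⊆-poset Attribute (o ⊔ a ⊔ r)) proj₁
  where open AttributeContinuousFormalContext ℙ

{-# OPTIONS --safe #-}
module Submission where

open import Defs
open import Axiom.ExcludedMiddle using (ExcludedMiddle)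
open import Data.List.Base using ([]; _∷_; [_])
open import Data.List.Relation.Unary.All as All using (All; []; _∷_)
open import Data.List.Relation.Unary.All.Properties using (++⁺; ++⁻ˡ; ++⁻ʳ)
open import Data.List.Relation.Unary.Any using (here)
open import Data.Product.Base using (Σ; ∃; ∃-syntax; _×_; _,_; proj₁; proj₂)
open import Function.Base using (_∘_)
open import Level using (Level; Lift; lift; lower; _⊔_; suc)
open import Relation.Binary.Bundles using (Poset)
open import Relation.Binary.PropositionalEquality.Core using (_≡_; refl)
open import Relation.Nullary.Decidable.Core using (True; toWitness; fromWitness)
open import Relation.Unary using (Pred; _∈_; _⊆_; _≐_)

-- A concept Q is the directed union of the sets ⌈F⌉ with F ∈ ℱ and F ⊑ Q, and
-- F ⊑ Q makes ⌈F⌉ way below Q because a finite subset of a directed union lies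
-- in one member of it; hence the sets ⌈F⌉ form a basis of 𝔅.
-- Conversely, a continuous domain D is recovered from the context with
-- objects and attributes D, x ⊨ y iff y ≤ x, the operator
-- τ X = {b : b ≪ x for some x ∈ X}, and ℱ the family of singletons. Then
-- ⌈{d}⌉ = {b : b ≪ d}, interpolation gives consistency, the concepts are
-- exactly the sets {b : b ≪ d}, and d is the least upper bound of its concept.

private
  variable
    o a r c ℓ ℓ₁ ℓ₂ : Level

-- Way-below and directed sets in an arbitrary poset.

module _ (P : Poset c ℓ₁ ℓ₂) where
  open Poset P using (Carrier; _≤_) renaming (refl to ≤-refl; trans to ≤-trans)

  -- Induction on `M`: a bound in `S` of the head's witness and of a common witness for the tail
  -- serves all entries.
  directed-bound : {A : Set a} {S : Pred Carrier ℓ} → IsDirected P S →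
                   (R : A → Carrier → Set r) →
                   (∀ {m x y} → R m x → x ≤ y → R m y) →
                   ∀ {M} → All (λ m → ∃[ x ] x ∈ S × R m x) M →
                   ∃[ x ] x ∈ S × All (λ m → R m x) M
  directed-bound ((s , s∈S) , _) R mono [] = s , s∈S , []
  directed-bound dir R mono ((x , x∈S , Rmx) ∷ rest) =
    let y , y∈S , RMy = directed-bound dir R mono rest
        z , z∈S , x≤z , y≤z = proj₂ dir x∈S y∈S
    in z , z∈S , mono Rmx x≤z ∷ All.map (λ Rmy → mono Rmy y≤z) RMy

  ≪⇒≤ : ∀ {x y} → WayBelow P x y → x ≤ y
  ≪⇒≤ {x} {y} x≪y =
    -- The test set is the down-set of `y`, directed with top element `y`.
    let _ , d≤y , x≤d = x≪y (λ z → Lift c (z ≤ y))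
          ((y , lift ≤-refl) , λ p q → y , lift ≤-refl , lower p , lower q)
          y (lower , λ v ub → ub (lift ≤-refl)) ≤-refl
    in ≤-trans x≤d (lower d≤y)

  ≪-respˡ-≤ : ∀ {w x y} → w ≤ x → WayBelow P x y → WayBelow P w y
  ≪-respˡ-≤ w≤x x≪y S dir u lub y≤u =
    let d , d∈S , x≤d = x≪y S dir u lub y≤u in d , d∈S , ≤-trans w≤x x≤d

  ≪-respʳ-≤ : ∀ {x y z} → WayBelow P x y → y ≤ z → WayBelow P x z
  ≪-respʳ-≤ x≪y y≤z S dir u lub z≤u = x≪y S dir u lub (≤-trans y≤z z≤u)

  module _ {S : Pred Carrier (c ⊔ ℓ₂)} {T : Pred Carrier ℓ} (x : Carrier)
           (dir : IsDirected P S) (lub : IsLub P S x)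
           (S⊆T : S ⊆ T) (T≪x : ∀ {y} → y ∈ T → WayBelow P y x) where

    -- Members of `T` are way below the supremum of `S`, hence lie below members of `S`, which have
    -- bounds in `S`. The level of `T` is free because the sets in `IsBasis` lie one level above
    -- those that `WayBelow` quantifies over.
    approximants-directed : IsDirected P T
    approximants-directed =
      (proj₁ (proj₁ dir) , S⊆T (proj₂ (proj₁ dir))) ,
      λ y∈T z∈T →
        let y′ , y′∈S , y≤y′ = T≪x y∈T S dir x lub ≤-refl
            z′ , z′∈S , z≤z′ = T≪x z∈T S dir x lub ≤-refl
            w , w∈S , y′≤w , z′≤w = proj₂ dir y′∈S z′∈S
        in w , S⊆T w∈S , ≤-trans y≤y′ y′≤w , ≤-trans z≤z′ z′≤w

    approximants-lub : IsLub P T x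
    approximants-lub =
      (λ y∈T → ≪⇒≤ (T≪x y∈T)) , λ v ub → proj₂ lub v (λ y∈S → ub (S⊆T y∈S))

module _ (em : ∀ {ℓ} → ExcludedMiddle ℓ) where

  -- Unions of concepts and ≪ live one level too high to be subsets in the sense
  -- of 𝒫; replacing a type by its truth value lowers the level.
  Resize : ∀ ℓ₂ → Set ℓ₁ → Set ℓ₂
  Resize ℓ₂ A = Lift ℓ₂ (True (em {P = A}))

  resize : {A : Set ℓ₁} → A → Resize ℓ₂ A
  resize x = lift (fromWitness x)

  unresize : {A : Set ℓ₁} → Resize ℓ₂ A → A
  unresize p = toWitness (lower p)

  -- Continuous concepts form a continuous domain.

  module Concepts (ℙ : AttributeContinuousFormalContext o a r) where
    open AttributeContinuousFormalContext ℙ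

    Concept : Set _
    Concept = Poset.Carrier (𝔅 ℙ)

    -- `τ-deflating` puts `G` inside the closure `α (ω F)`, so `τ-monotone` applies; `α ∘ ω` is
    -- idempotent, and `τ-cong` carries this through `τ`.
    ⌈⌉-mono : ∀ {F G} → G ⊑ ⌈ elements F ⌉ → ⌈ elements G ⌉ ⊆ ⌈ elements F ⌉
    ⌈⌉-mono {F} {G} G⊑ =
      proj₁ (τ-cong {α (ω (α (ω (elements F))))} {α (ω (elements F))}
               ( (λ p m mω → p m (λ n n∈ → n∈ m mω))
               , (λ p m mω → mω _ p)))
      ∘ τ-monotone (λ n∈G → τ-deflating (elements F) (All.lookup G⊑ (lower n∈G)))

    ⌈_⌉ᶜ : ∃ (_∈ ℱ) → Concept
    ⌈ F , F∈ℱ ⌉ᶜ = ⌈ elements F ⌉ , λ M M⊑ →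
      let G , G∈ℱ , M⊑G , G⊑F = consistent F∈ℱ M M⊑
      in G , G∈ℱ , M⊑G , ⌈⌉-mono G⊑F

    ⌈⌉⊆concept : ∀ {F} (Q : Concept) → F ⊑ proj₁ Q → ⌈ elements F ⌉ ⊆ proj₁ Q
    ⌈⌉⊆concept (Q , concept) F⊑Q =
      let G , _ , F⊑G , G⊆Q = concept _ F⊑Q in G⊆Q ∘ ⌈⌉-mono F⊑G

    -- `⌈ F ⌉ ⊆ Q` does not put `F` itself inside `Q`; consistency trades `F` for a `G` within
    -- `⌈ F ⌉`.
    refine : (Q : Concept) → ∀ M → M ⊑ proj₁ Q →
             ∃[ G ] G ∈ ℱ × M ⊑ ⌈ elements G ⌉ × G ⊑ proj₁ Q
    refine (Q , concept) M M⊑Q =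
      let F , F∈ℱ , M⊑F , F⊆Q = concept M M⊑Q
          G , G∈ℱ , M⊑G , G⊑F = consistent F∈ℱ M M⊑F
      in G , G∈ℱ , M⊑G , All.map F⊆Q G⊑F

    module _ {S : Pred Concept (suc (o ⊔ a ⊔ r))} (dir : IsDirected (𝔅 ℙ) S) where

      ⋃ : 𝒫 Attribute
      ⋃ n = Resize _ (∃[ Q ] Q ∈ S × n ∈ proj₁ Q)

      ⊑⋃⇒⊑member : ∀ {M} → M ⊑ ⋃ → ∃[ Q ] Q ∈ S × M ⊑ proj₁ Q
      ⊑⋃⇒⊑member M⊑⋃ =
        directed-bound (𝔅 ℙ) dir (λ n Q → n ∈ proj₁ Q) (λ n∈Q Q⊆R → Q⊆R n∈Q)
          (All.map unresize M⊑⋃)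

      ⋃ᶜ : Concept
      ⋃ᶜ = ⋃ , λ M M⊑⋃ →
        let (Q , concept) , Q∈S , M⊑Q = ⊑⋃⇒⊑member M⊑⋃
            F , F∈ℱ , M⊑F , F⊆Q = concept M M⊑Q
        in F , F∈ℱ , M⊑F , λ n∈F → resize (_ , Q∈S , F⊆Q n∈F)

      ⋃-lub : IsLub (𝔅 ℙ) S ⋃ᶜ
      ⋃-lub = (λ Q∈S n∈Q → resize (_ , Q∈S , n∈Q)) ,
        λ v ub n∈⋃ → let _ , Q∈S , n∈Q = unresize n∈⋃ in ub Q∈S n∈Q

    ⌈⌉-≪ : ∀ F Q → proj₁ F ⊑ proj₁ Q → WayBelow (𝔅 ℙ) ⌈ F ⌉ᶜ Q
    ⌈⌉-≪ F Q F⊑Q S dir u lub Q⊆u =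
      let R , R∈S , F⊑R = ⊑⋃⇒⊑member dir
            -- The union is an upper bound of `S`, so the supremum `u`, and with it `F`, lies inside
            -- the union.
            (All.map (λ n∈Q → proj₂ lub (⋃ᶜ dir) (proj₁ (⋃-lub dir)) (Q⊆u n∈Q)) F⊑Q)
      in R , R∈S , ⌈⌉⊆concept R F⊑R

    𝔅-isDCPO : IsDCPO (𝔅 ℙ)
    𝔅-isDCPO = record
      { nonempty         = ⌈ ℱ-nonempty ⌉ᶜ
      ; directedComplete = λ S dir → ⋃ᶜ dir , ⋃-lub dir
      }

    Base : Pred Concept (suc (o ⊔ a ⊔ r))
    Base X = ∃[ F ] X ≡ ⌈ F ⌉ᶜ

    -- A stand-in for the base elements way below `Q`: `F ⊑ Q` implies way-below and keeps the
    -- family at the level of the sets that `WayBelow` tests.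
    Generators : Concept → Pred Concept (suc (o ⊔ a ⊔ r))
    Generators Q X = ∃[ F ] X ≡ ⌈ F ⌉ᶜ × proj₁ F ⊑ proj₁ Q

    generators-directed : ∀ Q → IsDirected (𝔅 ℙ) (Generators Q)
    generators-directed Q =
      (let F , F∈ℱ , _ , F⊑Q = refine Q [] []
       in _ , (F , F∈ℱ) , refl , F⊑Q) ,
      λ { ((F , _) , refl , F⊑Q) (_ , refl , G⊑Q) →
        let H , H∈ℱ , FG⊑H , H⊑Q = refine Q _ (++⁺ F⊑Q G⊑Q)
        in _ , ((H , H∈ℱ) , refl , H⊑Q) ,
           ⌈⌉-mono (++⁻ˡ F FG⊑H) , ⌈⌉-mono (++⁻ʳ F FG⊑H) }

    generators-lub : ∀ Q → IsLub (𝔅 ℙ) (Generators Q) Q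
    generators-lub Q =
      (λ { (_ , refl , F⊑Q) → ⌈⌉⊆concept Q F⊑Q }) ,
      λ v ub {n} n∈Q →
        let F , F∈ℱ , n∈F , F⊑Q = refine Q [ n ] (n∈Q ∷ [])
        in ub ((F , F∈ℱ) , refl , F⊑Q) (All.head n∈F)

    𝔅-isBasis : IsBasis (𝔅 ℙ) Base
    𝔅-isBasis Q =
      approximants-directed (𝔅 ℙ) {T = T} Q dir lub generator⇒T proj₂ ,
      approximants-lub (𝔅 ℙ) {T = T} Q dir lub generator⇒T proj₂
      where
      dir = generators-directed Q
      lub = generators-lub Q
      T : Pred Concept _
      T X = X ∈ Base × WayBelow (𝔅 ℙ) X Q
      generator⇒T : Generators Q ⊆ T
      generator⇒T (F , refl , F⊑Q) = (F , refl) , ⌈⌉-≪ F Q F⊑Q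

    𝔅-isContinuousDomain : IsContinuousDomain (𝔅 ℙ)
    𝔅-isContinuousDomain = record { isDCPO = 𝔅-isDCPO ; basis = Base , 𝔅-isBasis }

  -- Representation of a continuous domain by a context.

  module Representation (D : Poset c ℓ₁ ℓ₂) (D-cont : IsContinuousDomain D) where
    open Poset D renaming (refl to ≤-refl; trans to ≤-trans)
    open IsContinuousDomain D-cont
    open IsDCPO isDCPO

    infix 4 _≪_
    _≪_ : Carrier → Carrier → Set (c ⊔ ℓ₂)
    x ≪ y = Resize _ (WayBelow D x y)

    ≪-mono : ∀ {w x y z} → w ≤ x → x ≪ y → y ≤ z → w ≪ z
    ≪-mono w≤x x≪y y≤z =
      resize (≪-respˡ-≤ D w≤x (≪-respʳ-≤ D (unresize x≪y) y≤z))

    ↡ : Carrier → Pred Carrier (c ⊔ ℓ₂)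
    ↡ x = _≪ x

    module _ (x : Carrier) where
      private
        B = proj₁ basis

        S : Pred Carrier (c ⊔ ℓ₂)
        S b = b ∈ B × b ≪ x

        dir : IsDirected D S
        dir = let ((b , b∈B , b≪x) , up) , _ = proj₂ basis x in
          (b , b∈B , resize b≪x) ,
          λ (y∈B , y≪x) (z∈B , z≪x) →
            let w , (w∈B , w≪x) , y≤w , z≤w =
                  up (y∈B , unresize y≪x) (z∈B , unresize z≪x)
            in w , (w∈B , resize w≪x) , y≤w , z≤w

        lub : IsLub D S x
        lub = let _ , ub , least = proj₂ basis x in
          (λ (b∈B , b≪x) → ub (b∈B , unresize b≪x)) ,
          λ v ub′ → least v (λ (b∈B , b≪x) → ub′ (b∈B , resize b≪x))

      -- The basis elements way below `x` are already directed with supremum `x`; `↡ x` only adds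
      -- further elements way below `x`.
      ↡-directed : IsDirected D (↡ x)
      ↡-directed = approximants-directed D x dir lub proj₂ unresize

      ↡-lub : IsLub D (↡ x) x
      ↡-lub = approximants-lub D x dir lub proj₂ unresize

    -- The elements way below something way below x are directed with supremum x.
    interpolate : ∀ {x y} → y ≪ x → ∃[ z ] z ≪ x × y ≪ z
    interpolate {x} y≪x =
      let w , (z , z≪x , w≪z) , y≤w = unresize y≪x S dir x lub ≤-refl
      in z , z≪x , ≪-mono y≤w w≪z ≤-refl
      where
      S : Pred Carrier (c ⊔ ℓ₂)
      S y = ∃[ z ] z ≪ x × y ≪ z

      dir : IsDirected D S
      dir =
        (let (z , z≪x) , _ = ↡-directed x
             (y , y≪z) , _ = ↡-directed z
         in y , z , z≪x , y≪z) ,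
        λ (z₁ , z₁≪x , y₁≪z₁) (z₂ , z₂≪x , y₂≪z₂) →
          let z , z≪x , z₁≤z , z₂≤z = proj₂ (↡-directed x) z₁≪x z₂≪x
              y , y≪z , y₁≤y , y₂≤y = proj₂ (↡-directed z)
                (≪-mono ≤-refl y₁≪z₁ z₁≤z) (≪-mono ≤-refl y₂≪z₂ z₂≤z)
          in y , (z , z≪x , y≪z) , y₁≤y , y₂≤y

      lub : IsLub D S x
      lub =
        (λ (z , z≪x , y≪z) →
          ≤-trans (proj₁ (↡-lub z) y≪z) (proj₁ (↡-lub x) z≪x)) ,
        λ v ub → proj₂ (↡-lub x) v λ {z} z≪x →
          proj₂ (↡-lub z) v λ y≪z → ub (z , z≪x , y≪z)

    -- Each entry is interpolated separately; directedness of `↡ x` then bounds the finitely many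
    -- interpolants.
    interpolate-finite : ∀ {x M} → M ⊑ ↡ x → ∃[ z ] z ≪ x × M ⊑ ↡ z
    interpolate-finite {x} M⊑ =
      directed-bound D (↡-directed x) _≪_ (≪-mono ≤-refl) (All.map interpolate M⊑)

    -- Here `ω` takes upper bounds and `α` lower bounds, so `α (ω B)` is the Dedekind-MacNeille
    -- closure of `B`.
    context : FormalContext c c ℓ₂
    context = record { Object = Carrier ; Attribute = Carrier ; _⊨_ = λ x y → y ≤ x }

    open FormalContext context using (α; ω; elements)

    operator : KernelAttributeOperator context
    operator = record
      { τ            = λ X b → ∃[ x ] x ∈ X × b ≪ x
      ; τ-cong       = λ (X⊆Y , Y⊆X) →
          (λ (x , x∈X , b≪x) → x , X⊆Y x∈X , b≪x) ,
          (λ (x , x∈Y , b≪x) → x , Y⊆X x∈Y , b≪x)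
      ; τ-deflating  = λ B (x , x∈ , b≪x) m mω →
          ≤-trans (≪⇒≤ D (unresize b≪x)) (x∈ m mω)
      ; τ-idempotent = λ B →
          (λ (y , (x , x∈ , y≪x) , b≪y) →
            x , x∈ , ≪-mono ≤-refl b≪y (≪⇒≤ D (unresize y≪x))) ,
          -- This half of idempotence is the interpolation property.
          (λ (x , x∈ , b≪x) →
            let y , y≪x , b≪y = interpolate b≪x in y , (x , x∈ , y≪x) , b≪y)
      ; τ-monotone   = λ B⊆B₁ (x , x∈ , b≪x) →
          x , (λ m mω → x∈ m (λ n n∈B → mω n (B⊆B₁ n∈B))) , b≪x
      }

    open KernelAttributeOperator operator using (⌈_⌉)

    -- The closure of the singleton is the down-set of `d`, because `d` is one of its upper bounds.
    ⌈singleton⌉ : ∀ d → ⌈ elements [ d ] ⌉ ≐ ↡ d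
    ⌈singleton⌉ d =
      (λ (x , x∈ , b≪x) →
        ≪-mono ≤-refl b≪x (x∈ d λ { _ (lift (here refl)) → ≤-refl })) ,
      λ b≪d → d , (λ m mω → mω d (lift (here refl))) , b≪d

    selection : ConsistentSelection operator
    selection = record
      { ℱ          = λ F → Lift ℓ₂ (∃[ d ] F ≡ [ d ])
      ; ℱ-nonempty = [ nonempty ] , lift (nonempty , refl)
      ; ∈ℱ⇒≢[]     = λ { (lift (_ , refl)) () }
      ; consistent = λ { (lift (d , refl)) M M⊑ →
          let g , g≪d , M≪g = interpolate-finite (All.map (proj₁ (⌈singleton⌉ d)) M⊑)
          in [ g ] , lift (g , refl) , All.map (proj₂ (⌈singleton⌉ g)) M≪g ,
             proj₂ (⌈singleton⌉ d) g≪d ∷ [] }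
      }

    ℙ : AttributeContinuousFormalContext c c ℓ₂
    ℙ = record { context = context ; operator = operator ; selection = selection }

    open AttributeContinuousFormalContext ℙ using (IsContinuousConcept)

    ↡-concept : ∀ d → IsContinuousConcept (↡ d)
    ↡-concept d M M⊑ =
      let g , g≪d , M≪g = interpolate-finite M⊑
      in [ g ] , lift (g , refl) , All.map (proj₂ (⌈singleton⌉ g)) M≪g ,
         λ b∈ → ≪-mono ≤-refl (proj₁ (⌈singleton⌉ g) b∈) (≪⇒≤ D (unresize g≪d))

    ↡-mono : ∀ {x y} → x ≤ y → ↡ x ⊆ ↡ y
    ↡-mono x≤y b≪x = ≪-mono ≤-refl b≪x x≤y

    -- `x` is the least upper bound of `↡ x`, and `y` bounds `↡ y`.
    ↡-cancel : ∀ {x y} → ↡ x ⊆ ↡ y → x ≤ y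
    ↡-cancel {x} {y} sub = proj₂ (↡-lub x) y (λ b≪x → proj₁ (↡-lub y) (sub b≪x))

    module _ {Q : Pred Carrier (c ⊔ ℓ₂)} (concept : IsContinuousConcept Q) where

      -- Members of `ℱ` are singletons, so the concept condition becomes one about sets `↡ d`.
      concept-covered : ∀ {M} → M ⊑ Q → ∃[ d ] M ⊑ ↡ d × ↡ d ⊆ Q
      concept-covered M⊑Q with concept _ M⊑Q
      ... | _ , lift (d , refl) , M⊑F , F⊆Q =
        d , All.map (proj₁ (⌈singleton⌉ d)) M⊑F , λ b≪d → F⊆Q (proj₂ (⌈singleton⌉ d) b≪d)

      concept-directed : IsDirected D Q
      concept-directed =
        (let d , _ , ↡d⊆Q = concept-covered []
             (b , b≪d) , _ = ↡-directed d
         in b , ↡d⊆Q b≪d) ,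
        λ x∈Q y∈Q →
          let d , xy≪d , ↡d⊆Q = concept-covered (x∈Q ∷ y∈Q ∷ [])
              z , z≪d , x≤z , y≤z =
                proj₂ (↡-directed d) (All.head xy≪d) (All.head (All.tail xy≪d))
          in z , ↡d⊆Q z≪d , x≤z , y≤z

      -- The witness is the supremum of `Q`: what is way below it lies below a member of `Q`, and
      -- `concept-covered` makes `Q` downward closed.
      concept-principal : ∃[ q ] ↡ q ≐ Q
      concept-principal =
        let q , ub , least = directedComplete Q concept-directed in
        q ,
        (λ x≪q →
          let y , y∈Q , x≤y = unresize x≪q Q concept-directed q (ub , least) ≤-refl
              d , y≪d , ↡d⊆Q = concept-covered (y∈Q ∷ [])
          in ↡d⊆Q (≪-mono x≤y (All.head y≪d) ≤-refl)) ,
        (λ x∈Q →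
          let d , x≪d , ↡d⊆Q = concept-covered (x∈Q ∷ [])
              -- Only `↡ d ⊆ Q` is known, not `d ∈ Q`; interpolation supplies a `g` in `Q` with
              -- `x ≪ g`.
              g , g≪d , x≪g = interpolate (All.head x≪d)
          in ≪-mono ≤-refl x≪g (ub (↡d⊆Q g≪d)))

    ↡-iso : D ≅ 𝔅 ℙ
    ↡-iso = (λ d → ↡ d , ↡-concept d) , record
      { isOrderMonomorphism = record
        { isOrderHomomorphism = record
          { cong = ↡-cong
          ; mono = ↡-mono
          }
        ; injective = λ (x⊆y , y⊆x) → antisym (↡-cancel x⊆y) (↡-cancel y⊆x)
        ; cancel    = ↡-cancel
        }
      ; surjective = λ (Q , concept) →
          let q , ↡q⊆Q , Q⊆↡q = concept-principal concept
          -- Surjectivity is demanded for every `z ≈ q`, not for `q` alone.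
          in q , λ z≈q →
               (λ b≪z → ↡q⊆Q (proj₁ (↡-cong z≈q) b≪z)) ,
               (λ b∈Q → proj₂ (↡-cong z≈q) (Q⊆↡q b∈Q))
      }
      where
      ↡-cong : ∀ {x y} → x ≈ y → ↡ x ≐ ↡ y
      ↡-cong x≈y = ↡-mono (reflexive x≈y) , ↡-mono (reflexive (Eq.sym x≈y))

theorem3p15 : (∀ {ℓ} → ExcludedMiddle ℓ) →
    ∀ {o a r c ℓ₁ ℓ₂} →
    ((ℙ : AttributeContinuousFormalContext o a r) → IsContinuousDomain (𝔅 ℙ)) ×
    ((D : Poset c ℓ₁ ℓ₂) → IsContinuousDomain D →
    Σ (AttributeContinuousFormalContext c c ℓ₂) λ ℙ → D ≅ 𝔅 ℙ)
theorem3p15 em =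
  Concepts.𝔅-isContinuousDomain em ,
  λ D D-cont → let open Representation em D D-cont in ℙ , ↡-iso
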